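{- Let $a,a^{+}$ be boson operators with $aa^{+}-a^{+}a=1$ and let $\lambda$ be a nonzero real number. For all integers $m,n\ge0$, \[ (a^{+}a)_{m+n,\lambda}=\sum_{j=0}^{m}{m\brace j}_\lambda (a^{+})^{j}\,(a^{+}a+j-m\lambda)_{n,\lambda}\,a^{j}. \]
   Context: For an operator $X$ and real $\lambda\neq0$, $(X)_{0,\lambda}=1$ and $(X)_{n,\lambda}=X(X-\lambda)\cdots(X-(n-1)\lambda)$ for $n\ge1$ (scalars mean multiples of the identity). The degenerate Stirling numbers of the second kind ${n\brace k}_\lambda$ are defined by $(x)_{n,\lambda}=\sum_{k=0}^{n}{n\brace k}_\lambda (x)_k$, where $(x)_k=x(x-1)\cdots(x-k+1)$. -}

module Defs where

open import Algebra.Bundles using (Ring; CommutativeRing; Semiring)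
import Algebra.Definitions.RawSemiring as RawSemiringDefs
open import Algebra.Module.Structures using (IsLeftModule)
open import Algebra.Structures using (IsCommutativeRing)
open import Data.Fin.Base using (toℕ)
open import Data.Nat.Base as ℕ using (ℕ; zero; suc)
import Data.Nat.Properties as ℕ
open import Data.Product.Base using (_,_; proj₁; proj₂; ∃-syntax)
open import Data.Rational.Base as ℚ using (ℚ; 0ℚ; 1ℚ; ½)
import Data.Rational.Properties as ℚ
open import Data.Rational.Solver using (module +-*-Solver)
open import Level using (Level; 0ℓ; _⊔_) renaming (suc to lsuc)
open import Relation.Binary.PropositionalEquality
  using (_≡_; refl; sym; trans; cong; subst; subst₂)

private
  variable
    c ℓ : Level

-- The standard library has no real numbers: they are built here as Cauchy
-- sequences of rationals, two sequences being equal when their difference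
-- tends to zero.

record ℝ : Set where
  constructor mkℝ
  field
    seq    : ℕ → ℚ
    cauchy : ∀ ε → 0ℚ ℚ.< ε →
             ∃[ N ] (∀ m n → N ℕ.≤ m → N ℕ.≤ n → ℚ.∣ seq m ℚ.- seq n ∣ ℚ.< ε)

open ℝ

infix 4 _≈ℝ_
_≈ℝ_ : ℝ → ℝ → Set
x ≈ℝ y = ∀ ε → 0ℚ ℚ.< ε →
         ∃[ N ] (∀ n → N ℕ.≤ n → ℚ.∣ seq x n ℚ.- seq y n ∣ ℚ.< ε)

private
  half>0 : ∀ {ε} → 0ℚ ℚ.< ε → 0ℚ ℚ.< ½ ℚ.* ε
  half>0 {ε} p = subst (ℚ._< ½ ℚ.* ε) (ℚ.*-zeroʳ ½) (ℚ.*-monoʳ-<-pos ½ p)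

  halves : ∀ ε → ½ ℚ.* ε ℚ.+ ½ ℚ.* ε ≡ ε
  halves ε = trans (sym (ℚ.*-distribʳ-+ ε ½ ½)) (ℚ.*-identityˡ ε)

  sum-close : ∀ {p q r ε} → ℚ.∣ p ∣ ℚ.< ½ ℚ.* ε → ℚ.∣ q ∣ ℚ.< ½ ℚ.* ε →
              p ℚ.+ q ≡ r → ℚ.∣ r ∣ ℚ.< ε
  sum-close {p} {q} {ε = ε} hp hq eq = subst (λ t → ℚ.∣ t ∣ ℚ.< ε) eq
    (ℚ.≤-<-trans (ℚ.∣p+q∣≤∣p∣+∣q∣ p q)
      (subst (ℚ.∣ p ∣ ℚ.+ ℚ.∣ q ∣ ℚ.<_) (halves ε) (ℚ.+-mono-< hp hq)))

  interchange : ∀ p q r s →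
    (p ℚ.- q) ℚ.+ (r ℚ.- s) ≡ (p ℚ.+ r) ℚ.- (q ℚ.+ s)
  interchange = solve 4 (λ p q r s →
    (p :- q) :+ (r :- s) := (p :+ r) :- (q :+ s)) refl
    where open +-*-Solver

  telescope : ∀ p q r → (p ℚ.- q) ℚ.+ (q ℚ.- r) ≡ p ℚ.- r
  telescope = solve 3 (λ p q r → (p :- q) :+ (q :- r) := p :- r) refl
    where open +-*-Solver

  product-difference : ∀ p q p′ q′ →
    p ℚ.* (q ℚ.- q′) ℚ.+ (p ℚ.- p′) ℚ.* q′ ≡ p ℚ.* q ℚ.- p′ ℚ.* q′
  product-difference = solve 4 (λ p q p′ q′ →
    p :* (q :- q′) :+ (p :- p′) :* q′ := p :* q :- p′ :* q′) refl
    where open +-*-Solver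

  neg-difference : ∀ p q → ℚ.∣ (ℚ.- p) ℚ.- (ℚ.- q) ∣ ≡ ℚ.∣ p ℚ.- q ∣
  neg-difference p q = trans (cong ℚ.∣_∣ (lemma p q)) (ℚ.∣-p∣≡∣p∣ (p ℚ.- q))
    where
    open +-*-Solver
    lemma : ∀ p q → (ℚ.- p) ℚ.- (ℚ.- q) ≡ ℚ.- (p ℚ.- q)
    lemma = solve 2 (λ p q → (:- p) :- (:- q) := :- (p :- q)) refl

  ∣p-q∣≡∣q-p∣ : ∀ p q → ℚ.∣ p ℚ.- q ∣ ≡ ℚ.∣ q ℚ.- p ∣
  ∣p-q∣≡∣q-p∣ p q = trans (sym (ℚ.∣-p∣≡∣p∣ (p ℚ.- q))) (cong ℚ.∣_∣ (lemma p q))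
    where
    open +-*-Solver
    lemma : ∀ p q → ℚ.- (p ℚ.- q) ≡ q ℚ.- p
    lemma = solve 2 (λ p q → :- (p :- q) := q :- p) refl

  ∣p-p∣<ε : ∀ {p q ε} → 0ℚ ℚ.< ε → p ≡ q → ℚ.∣ p ℚ.- q ∣ ℚ.< ε
  ∣p-p∣<ε {p} {ε = ε} ε>0 refl =
    subst (λ t → ℚ.∣ t ∣ ℚ.< ε) (sym (ℚ.+-inverseʳ p)) ε>0

  ≤⊔ˡ : ∀ {M N n} → M ℕ.⊔ N ℕ.≤ n → M ℕ.≤ n
  ≤⊔ˡ {M} {N} = ℕ.m⊔n≤o⇒m≤o M N

  ≤⊔ʳ : ∀ {M N n} → M ℕ.⊔ N ℕ.≤ n → N ℕ.≤ n
  ≤⊔ʳ {M} {N} = ℕ.m⊔n≤o⇒n≤o M N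

  0<1 : 0ℚ ℚ.< 1ℚ
  0<1 = ℚ.positive⁻¹ 1ℚ

  module _ (B : ℚ) .{{B>0 : ℚ.Positive B}} where

    private instance
      _ = ℚ.pos⇒nonZero B
      _ = ℚ.pos⇒nonNeg B

    shrink : ℚ → ℚ
    shrink ε = (ℚ.1/ B) ℚ.* ε

    shrink>0 : ∀ {ε} → 0ℚ ℚ.< ε → 0ℚ ℚ.< shrink ε
    shrink>0 {ε} p = subst (ℚ._< shrink ε) (ℚ.*-zeroʳ (ℚ.1/ B))
      (ℚ.*-monoʳ-<-pos (ℚ.1/ B) {{ℚ.1/pos⇒pos B}} p)

    shrink-bound : ∀ {p q ε} → ℚ.∣ p ∣ ℚ.≤ B → ℚ.∣ q ∣ ℚ.< shrink ε →
                   ℚ.∣ p ℚ.* q ∣ ℚ.< ε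
    shrink-bound {p} {q} {ε} hp hq = subst₂ ℚ._<_ (sym (ℚ.∣p*q∣≡∣p∣*∣q∣ p q))
      (trans (sym (ℚ.*-assoc B (ℚ.1/ B) ε))
        (trans (cong (ℚ._* ε) (ℚ.*-inverseʳ B)) (ℚ.*-identityˡ ε)))
      (ℚ.≤-<-trans
        (ℚ.*-monoʳ-≤-nonNeg ℚ.∣ q ∣ {{ℚ.∣-∣-nonNeg q}} hp)
        (ℚ.*-monoʳ-<-pos B hq))

  record Bound (x : ℝ) : Set where
    field
      bound     : ℚ
      bound>0   : ℚ.Positive bound
      threshold : ℕ
      bounded   : ∀ n → threshold ℕ.≤ n → ℚ.∣ seq x n ∣ ℚ.≤ bound

  open Bound

  eventually-bounded : ∀ x → Bound x
  eventually-bounded x with cauchy x 1ℚ 0<1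
  ... | N , close = record
    { bound     = 1ℚ ℚ.+ ℚ.∣ seq x N ∣
    ; bound>0   = ℚ.pos+nonNeg⇒pos 1ℚ ℚ.∣ seq x N ∣ {{ℚ.∣-∣-nonNeg (seq x N)}}
    ; threshold = N
    ; bounded   = λ n N≤n → ℚ.≤-trans
        (subst (λ t → ℚ.∣ t ∣ ℚ.≤ ℚ.∣ seq x n ℚ.- seq x N ∣ ℚ.+ ℚ.∣ seq x N ∣)
            (lemma (seq x n) (seq x N))
          (ℚ.∣p+q∣≤∣p∣+∣q∣ (seq x n ℚ.- seq x N) (seq x N)))
        (ℚ.+-monoˡ-≤ ℚ.∣ seq x N ∣ (ℚ.<⇒≤ (close n N N≤n ℕ.≤-refl)))
    }
    where
    open +-*-Solver
    lemma : ∀ p q → (p ℚ.- q) ℚ.+ q ≡ p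
    lemma = solve 2 (λ p q → (p :- q) :+ q := p) refl

  products-close : ∀ {p q p′ q′ ε} B C
    .{{_ : ℚ.Positive B}} .{{_ : ℚ.Positive C}} →
    ℚ.∣ p ∣ ℚ.≤ B → ℚ.∣ q′ ∣ ℚ.≤ C →
    ℚ.∣ q ℚ.- q′ ∣ ℚ.< shrink B (½ ℚ.* ε) →
    ℚ.∣ p ℚ.- p′ ∣ ℚ.< shrink C (½ ℚ.* ε) →
    ℚ.∣ p ℚ.* q ℚ.- p′ ℚ.* q′ ∣ ℚ.< ε
  products-close {p} {q} {p′} {q′} {ε} B C hp hq′ hq hpp =
    sum-close {p ℚ.* (q ℚ.- q′)} {(p ℚ.- p′) ℚ.* q′}
      (shrink-bound B {p} hp hq)
      (subst (λ t → ℚ.∣ t ∣ ℚ.< ½ ℚ.* ε) (ℚ.*-comm q′ (p ℚ.- p′))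
        (shrink-bound C {q′} hq′ hpp))
      (product-difference p q p′ q′)

fromℚ : ℚ → ℝ
fromℚ p = mkℝ (λ _ → p) λ ε ε>0 → 0 , λ _ _ _ _ → ∣p-p∣<ε {p} ε>0 refl

infixl 6 _+ℝ_
_+ℝ_ : ℝ → ℝ → ℝ
seq (x +ℝ y) n = seq x n ℚ.+ seq y n
cauchy (x +ℝ y) ε ε>0
  with cauchy x _ (half>0 ε>0) | cauchy y _ (half>0 ε>0)
... | M , hx | N , hy = M ℕ.⊔ N , λ m n hm hn → sum-close
  (hx m n (≤⊔ˡ hm) (≤⊔ˡ hn)) (hy m n (≤⊔ʳ {M} hm) (≤⊔ʳ {M} hn))
  (interchange (seq x m) (seq x n) (seq y m) (seq y n))

infix 8 -ℝ_
-ℝ_ : ℝ → ℝ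
seq (-ℝ x) n = ℚ.- seq x n
cauchy (-ℝ x) ε ε>0 with cauchy x ε ε>0
... | N , hx = N , λ m n hm hn →
  subst (ℚ._< ε) (sym (neg-difference (seq x m) (seq x n))) (hx m n hm hn)

infixl 7 _*ℝ_
_*ℝ_ : ℝ → ℝ → ℝ
seq (x *ℝ y) n = seq x n ℚ.* seq y n
cauchy (x *ℝ y) ε ε>0 =
  K ℕ.⊔ (L ℕ.⊔ (M ℕ.⊔ N)) , λ m n hm hn →
    let hm₁ = ≤⊔ʳ {K} hm; hn₁ = ≤⊔ʳ {K} hn
        hm₂ = ≤⊔ʳ {L} hm₁; hn₂ = ≤⊔ʳ {L} hn₁
    in products-close (bound bx) (bound by)
         (bounded bx m (≤⊔ˡ hm)) (bounded by n (≤⊔ˡ hn₁))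
         (proj₂ cy m n (≤⊔ˡ hm₂) (≤⊔ˡ hn₂))
         (proj₂ cx m n (≤⊔ʳ {M} hm₂) (≤⊔ʳ {M} hn₂))
  where
  bx = eventually-bounded x
  by = eventually-bounded y
  instance
    _ = bound>0 bx
    _ = bound>0 by
  cy = cauchy y _ (shrink>0 (bound bx) {{bound>0 bx}} (half>0 ε>0))
  cx = cauchy x _ (shrink>0 (bound by) {{bound>0 by}} (half>0 ε>0))
  K = threshold bx
  L = threshold by
  M = proj₁ cy
  N = proj₁ cx

0ℝ 1ℝ : ℝ
0ℝ = fromℚ 0ℚ
1ℝ = fromℚ 1ℚ

private
  pointwise : ∀ x y → (∀ n → seq x n ≡ seq y n) → x ≈ℝ y
  pointwise x y eq ε ε>0 = 0 , λ n _ → ∣p-p∣<ε ε>0 (eq n)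

  ≈ℝ-sym : ∀ {x y} → x ≈ℝ y → y ≈ℝ x
  ≈ℝ-sym {x} {y} h ε ε>0 with h ε ε>0
  ... | N , close = N , λ n hn →
    subst (ℚ._< ε) (∣p-q∣≡∣q-p∣ (seq x n) (seq y n)) (close n hn)

  ≈ℝ-trans : ∀ {x y z} → x ≈ℝ y → y ≈ℝ z → x ≈ℝ z
  ≈ℝ-trans {x} {y} {z} h k ε ε>0
    with h _ (half>0 ε>0) | k _ (half>0 ε>0)
  ... | M , hM | N , kN = M ℕ.⊔ N , λ n hn →
    sum-close (hM n (≤⊔ˡ hn)) (kN n (≤⊔ʳ {M} hn))
      (telescope (seq x n) (seq y n) (seq z n))

  +ℝ-cong : ∀ {x x′ y y′} → x ≈ℝ x′ → y ≈ℝ y′ → x +ℝ y ≈ℝ x′ +ℝ y′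
  +ℝ-cong {x} {x′} {y} {y′} h k ε ε>0
    with h _ (half>0 ε>0) | k _ (half>0 ε>0)
  ... | M , hM | N , kN = M ℕ.⊔ N , λ n hn →
    sum-close (hM n (≤⊔ˡ hn)) (kN n (≤⊔ʳ {M} hn))
      (interchange (seq x n) (seq x′ n) (seq y n) (seq y′ n))

  -ℝ-cong : ∀ {x x′} → x ≈ℝ x′ → -ℝ x ≈ℝ -ℝ x′
  -ℝ-cong {x} {x′} h ε ε>0 with h ε ε>0
  ... | N , close = N , λ n hn →
    subst (ℚ._< ε) (sym (neg-difference (seq x n) (seq x′ n))) (close n hn)

  *ℝ-cong : ∀ {x x′ y y′} → x ≈ℝ x′ → y ≈ℝ y′ → x *ℝ y ≈ℝ x′ *ℝ y′
  *ℝ-cong {x} {x′} {y} {y′} h k ε ε>0 =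
    K ℕ.⊔ (L ℕ.⊔ (M ℕ.⊔ N)) , λ n hn →
      let hn₁ = ≤⊔ʳ {K} hn
          hn₂ = ≤⊔ʳ {L} hn₁
      in products-close (bound bx) (bound by)
           (bounded bx n (≤⊔ˡ hn)) (bounded by n (≤⊔ˡ hn₁))
           (proj₂ cy n (≤⊔ˡ hn₂)) (proj₂ cx n (≤⊔ʳ {M} hn₂))
    where
    bx = eventually-bounded x
    by = eventually-bounded y′
    instance
      _ = bound>0 bx
      _ = bound>0 by
    cy = k _ (shrink>0 (bound bx) {{bound>0 bx}} (half>0 ε>0))
    cx = h _ (shrink>0 (bound by) {{bound>0 by}} (half>0 ε>0))
    K = threshold bx
    L = threshold by
    M = proj₁ cy
    N = proj₁ cx

  ℝ-isCommutativeRing : IsCommutativeRing _≈ℝ_ _+ℝ_ _*ℝ_ -ℝ_ 0ℝ 1ℝ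
  ℝ-isCommutativeRing = record
    { isRing = record
      { +-isAbelianGroup = record
        { isGroup = record
          { isMonoid = record
            { isSemigroup = record
              { isMagma = record
                { isEquivalence = record
                  { refl  = λ {x} → pointwise x x λ _ → refl
                  ; sym   = λ {x} {y} → ≈ℝ-sym {x} {y}
                  ; trans = λ {x} {y} {z} → ≈ℝ-trans {x} {y} {z}
                  }
                ; ∙-cong = λ {x} {x′} {y} {y′} → +ℝ-cong {x} {x′} {y} {y′}
                }
              ; assoc = λ x y z → pointwise (x +ℝ y +ℝ z) (x +ℝ (y +ℝ z))
                  λ n → ℚ.+-assoc (seq x n) (seq y n) (seq z n)
              }
            ; identity =
                (λ x → pointwise (0ℝ +ℝ x) x λ n → ℚ.+-identityˡ (seq x n))
              , (λ x → pointwise (x +ℝ 0ℝ) x λ n → ℚ.+-identityʳ (seq x n))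
            }
          ; inverse =
              (λ x → pointwise (-ℝ x +ℝ x) 0ℝ λ n → ℚ.+-inverseˡ (seq x n))
            , (λ x → pointwise (x +ℝ -ℝ x) 0ℝ λ n → ℚ.+-inverseʳ (seq x n))
          ; ⁻¹-cong = λ {x} {x′} → -ℝ-cong {x} {x′}
          }
        ; comm = λ x y → pointwise (x +ℝ y) (y +ℝ x)
            λ n → ℚ.+-comm (seq x n) (seq y n)
        }
      ; *-cong = λ {x} {x′} {y} {y′} → *ℝ-cong {x} {x′} {y} {y′}
      ; *-assoc = λ x y z → pointwise (x *ℝ y *ℝ z) (x *ℝ (y *ℝ z))
          λ n → ℚ.*-assoc (seq x n) (seq y n) (seq z n)
      ; *-identity =
          (λ x → pointwise (1ℝ *ℝ x) x λ n → ℚ.*-identityˡ (seq x n))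
        , (λ x → pointwise (x *ℝ 1ℝ) x λ n → ℚ.*-identityʳ (seq x n))
      ; distrib =
          (λ x y z → pointwise (x *ℝ (y +ℝ z)) (x *ℝ y +ℝ x *ℝ z)
            λ n → ℚ.*-distribˡ-+ (seq x n) (seq y n) (seq z n))
        , (λ x y z → pointwise ((y +ℝ z) *ℝ x) (y *ℝ x +ℝ z *ℝ x)
            λ n → ℚ.*-distribʳ-+ (seq x n) (seq y n) (seq z n))
      }
    ; *-comm = λ x y → pointwise (x *ℝ y) (y *ℝ x)
        λ n → ℚ.*-comm (seq x n) (seq y n)
    }

ℝ-commutativeRing : CommutativeRing 0ℓ 0ℓ
ℝ-commutativeRing = record { isCommutativeRing = ℝ-isCommutativeRing }

ℝ-ring : Ring 0ℓ 0ℓ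
ℝ-ring = CommutativeRing.ring ℝ-commutativeRing

fromℕ : ℕ → ℝ
fromℕ n = n × 1ℝ
  where open RawSemiringDefs (Semiring.rawSemiring (Ring.semiring ℝ-ring)) using (_×_)

module RingNotation (R : Ring c ℓ) where
  open Ring R
  open RawSemiringDefs (Semiring.rawSemiring semiring) public using (_^_)
  open RawSemiringDefs (Semiring.rawSemiring semiring) using (_×_; sum)

  -- Σ_{j=0}^{m} f j, upper limit included
  sumTo : ℕ → (ℕ → Carrier) → Carrier
  sumTo m f = sum {suc m} λ j → f (toℕ j)

  -- x (x − s) ⋯ (x − (n−1)s)
  fallingFactorial : Carrier → Carrier → ℕ → Carrier
  fallingFactorial s x zero    = 1#
  fallingFactorial s x (suc n) = fallingFactorial s x n * (x - n × s)

-- The defining expansion (x)_{n,λ} = Σ_{k=0}^{n} S n k (x)_k, as an identity in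
-- a real variable x. It determines S n k for k ≤ n and leaves S n k
-- unconstrained for k > n.
IsDegenerateStirling₂ : ℝ → (ℕ → ℕ → ℝ) → Set
IsDegenerateStirling₂ lam S = ∀ n x →
  fallingFactorial lam x n ≈ℝ sumTo n (λ k → S n k *ℝ fallingFactorial 1ℝ x k)
  where open RingNotation ℝ-ring

-- Operators are elements of an associative unital real algebra, for instance
-- the linear endomorphisms of a real or complex vector space.
record RealAlgebra c ℓ : Set (lsuc (c ⊔ ℓ)) where
  infixr 7 _•_
  field
    ring : Ring c ℓ
  open Ring ring public
  field
    _•_          : ℝ → Carrier → Carrier
    isLeftModule : IsLeftModule ℝ-ring _≈_ _+_ 0# -_ _•_
    •-*-assocˡ   : ∀ r x y → (r • x) * y ≈ r • (x * y)
    •-*-assocʳ   : ∀ r x y → x * (r • y) ≈ r • (x * y)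

  open RingNotation ring public

  scalar : ℝ → Carrier
  scalar r = r • 1#

  -- (X)_{n,λ}
  degenerateFactorial : ℝ → Carrier → ℕ → Carrier
  degenerateFactorial lam = fallingFactorial (scalar lam)

{-# OPTIONS --safe #-}
module Submission where

-- Put N = a⁺a. Since a^j N = (N + j) a^j, the j-th summand on the right equals
-- S m j (N)_j (N − mλ)_{n,λ}, and (N)_{m,λ} (N − mλ)_{n,λ} = (N)_{m+n,λ}; so what
-- remains is (N)_{m,λ} = Σ_j S m j (N)_j. The numbers S m j are only given by this
-- identity for real N. A solution of the Stirling recurrence satisfies it in
-- every algebra, and over ℝ the coefficients are unique (evaluate at 0, 1, …, m),
-- so S agrees with that solution.

open import Algebra.Bundles using (CommutativeRing; Ring)
open import Algebra.Module.Bundles using (LeftModule)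
import Algebra.Module.Construct.TensorUnit as TensorUnit
open import Algebra.Module.Structures using (IsLeftModule)
import Algebra.Properties.AbelianGroup as AbelianGroupProperties
import Algebra.Properties.Group as GroupProperties
import Algebra.Properties.Loop as LoopProperties
import Algebra.Properties.Ring as RingProperties
import Algebra.Properties.Semiring.Mult as Mult
import Algebra.Properties.Semiring.Sum as Sum
open import Data.Fin.Base using (Fin; zero; suc; toℕ; fromℕ<; punchIn)
import Data.Fin.Properties as Fin
open import Data.Nat.Base as ℕ using (ℕ; zero; suc; s≤s⁻¹)
open import Data.Nat.Induction using (<-rec)
import Data.Nat.Properties as ℕ
open import Data.Product.Base using (_,_; ∃-syntax)
open import Data.Rational.Base as ℚ using (ℚ; 0ℚ; 1ℚ)
import Data.Rational.Properties as ℚ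
open import Data.Sum.Base using (inj₁; inj₂)
open import Function.Base using (_∘_)
open import Level using (Level; _⊔_)
open import Relation.Binary.Definitions using (tri<; tri≈; tri>)
import Relation.Binary.PropositionalEquality.Core as ≡
open ≡ using (_≡_; _≢_)
import Relation.Binary.Reasoning.Setoid as SetoidReasoning
open import Relation.Nullary.Negation.Core using (¬_; contradiction)
open import Defs

private
  variable
    c ℓ c′ ℓ′ : Level

-- Sums and falling factorials in an arbitrary ring.

module FallingFactorials (R : Ring c ℓ) where
  open Ring R
  open RingNotation R public
  open RingProperties R using (x[y-z]≈xy-xz; [y-z]x≈yx-zx)
  open AbelianGroupProperties +-abelianGroup using (⁻¹-∙-comm)
  open GroupProperties +-group using (//-rightDividesʳ; //-rightDividesˡ; loop)
  open LoopProperties loop using (identityˡ-unique)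
  open Mult semiring public
  open Sum semiring
  open SetoidReasoning setoid

  -‿cong₂ : ∀ {x x′ y y′} → x ≈ x′ → y ≈ y′ → x - y ≈ x′ - y′
  -‿cong₂ p q = +-cong p (-‿cong q)

  x-y-z≈x-[y+z] : ∀ x y z → x - y - z ≈ x - (y + z)
  x-y-z≈x-[y+z] x y z = trans (+-assoc x (- y) (- z)) (+-congˡ (⁻¹-∙-comm y z))

  x-z≈[x-y]+[y-z] : ∀ x y z → x - z ≈ (x - y) + (y - z)
  x-z≈[x-y]+[y-z] x y z = begin
    x - z                ≈⟨ +-congʳ (//-rightDividesˡ y x) ⟨
    x - y + y - z        ≈⟨ +-assoc (x - y) y (- z) ⟩
    (x - y) + (y - z)    ∎

  [y+x]-y≈x : ∀ x y → y + x - y ≈ x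
  [y+x]-y≈x x y = trans (+-congʳ (+-comm y x)) (//-rightDividesʳ y x)

  sumTo-cong : ∀ m (f g : ℕ → Carrier) → (∀ k → k ℕ.≤ m → f k ≈ g k) → sumTo m f ≈ sumTo m g
  sumTo-cong m f g f≈g = sum-cong-≋ λ i → f≈g (toℕ i) (s≤s⁻¹ (Fin.toℕ<n i))

  sumTo-+ : ∀ m (f g : ℕ → Carrier) → sumTo m (λ k → f k + g k) ≈ sumTo m f + sumTo m g
  sumTo-+ m f g = ∑-distrib-+ {suc m} (f ∘ toℕ) (g ∘ toℕ)

  sumTo-*ʳ : ∀ m (f : ℕ → Carrier) x → sumTo m f * x ≈ sumTo m (λ k → f k * x)
  sumTo-*ʳ m f x = *-distribʳ-sum {suc m} x (f ∘ toℕ)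

  sumTo-last : ∀ m (f : ℕ → Carrier) → sumTo (suc m) f ≈ sumTo m f + f (suc m)
  sumTo-last zero    f = trans (+-congˡ (+-identityʳ _)) (+-congʳ (sym (+-identityʳ _)))
  sumTo-last (suc m) f = trans (+-congˡ (sumTo-last m (f ∘ suc))) (sym (+-assoc _ _ _))

  sumTo-single : ∀ m (f : ℕ → Carrier) k → k ℕ.≤ m → (∀ j → j ℕ.≤ m → j ≢ k → f j ≈ 0#) →
                 sumTo m f ≈ f k
  sumTo-single m f k k≤m f≈0 = begin
    sumTo m f                                      ≈⟨ sum-remove {m} {i} (f ∘ toℕ) ⟩
    f (toℕ i) + sum (λ j → f (toℕ (punchIn i j)))  ≈⟨ +-congˡ (sum-cong-≋ others≈0) ⟩
    f (toℕ i) + sum {m} (λ _ → 0#)                 ≈⟨ +-congˡ (sum-replicate-zero m) ⟩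
    f (toℕ i) + 0#                                 ≈⟨ +-identityʳ _ ⟩
    f (toℕ i)                                      ≡⟨ ≡.cong f toℕi≡k ⟩
    f k                                            ∎
    where
    i : Fin (suc m)
    i = fromℕ< (ℕ.s≤s k≤m)

    toℕi≡k : toℕ i ≡ k
    toℕi≡k = Fin.toℕ-fromℕ< (ℕ.s≤s k≤m)

    others≈0 : ∀ j → f (toℕ (punchIn i j)) ≈ 0#
    others≈0 j = f≈0 _ (s≤s⁻¹ (Fin.toℕ<n (punchIn i j))) λ eq →
      Fin.punchInᵢ≢i i j (Fin.toℕ-injective (≡.trans eq (≡.sym toℕi≡k)))

  fallingFactorial-cong : ∀ {s s′ x x′} n → s ≈ s′ → x ≈ x′ →
                          fallingFactorial s x n ≈ fallingFactorial s′ x′ n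
  fallingFactorial-cong zero    s≈s′ x≈x′ = refl
  fallingFactorial-cong (suc n) s≈s′ x≈x′ =
    *-cong (fallingFactorial-cong n s≈s′ x≈x′) (-‿cong₂ x≈x′ (×-congʳ n s≈s′))

  -- The factor `x - (m + n) × s` is `(x - m × s) - n × s`, which is the next factor of the product
  -- started at `x - m × s`. Factors are appended on the right, so associativity alone regroups
  -- them.
  fallingFactorial-+ : ∀ s x m n → fallingFactorial s x (m ℕ.+ n) ≈
                       fallingFactorial s x m * fallingFactorial s (x - m × s) n
  fallingFactorial-+ s x m zero rewrite ℕ.+-identityʳ m = sym (*-identityʳ _)
  fallingFactorial-+ s x m (suc n) rewrite ℕ.+-suc m n = begin
    fallingFactorial s x (m ℕ.+ n) * (x - (m ℕ.+ n) × s)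
      ≈⟨ *-cong (fallingFactorial-+ s x m n) (begin
           x - (m ℕ.+ n) × s      ≈⟨ -‿cong₂ refl (×-homo-+ s m n) ⟩
           x - (m × s + n × s)    ≈⟨ x-y-z≈x-[y+z] x (m × s) (n × s) ⟨
           x - m × s - n × s      ∎) ⟩
    fallingFactorial s x m * fallingFactorial s (x - m × s) n * (x - m × s - n × s)
      ≈⟨ *-assoc _ _ _ ⟩
    fallingFactorial s x m * fallingFactorial s (x - m × s) (suc n) ∎

  ×-commute : ∀ {x y} n → x * y ≈ y * x → x * (n × y) ≈ (n × y) * x
  ×-commute {x} {y} n xy≈yx = begin
    x * (n × y)    ≈⟨ ×-comm-* n x y ⟩
    n × (x * y)    ≈⟨ ×-congʳ n xy≈yx ⟩
    n × (y * x)    ≈⟨ ×-assoc-* n y x ⟨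
    (n × y) * x    ∎

  1#-commute : ∀ x → x * 1# ≈ 1# * x
  1#-commute x = trans (*-identityʳ x) (sym (*-identityˡ x))

  intertwine-- : ∀ {x y y′ u} → x * y ≈ y′ * x → x * u ≈ u * x →
                 x * (y - u) ≈ (y′ - u) * x
  intertwine-- {x} {y} {y′} {u} xy≈y′x xu≈ux = begin
    x * (y - u)      ≈⟨ x[y-z]≈xy-xz x y u ⟩
    x * y - x * u    ≈⟨ -‿cong₂ xy≈y′x xu≈ux ⟩
    y′ * x - u * x   ≈⟨ [y-z]x≈yx-zx x y′ u ⟨
    (y′ - u) * x     ∎

  -- Moving `x` rightwards past one factor after another turns each `y` into `y′` and leaves the
  -- shifts alone. It is applied with a power of the annihilation operator as `x`.
  intertwine-fallingFactorial : ∀ {s x y y′} n → x * y ≈ y′ * x → x * s ≈ s * x →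
    x * fallingFactorial s y n ≈ fallingFactorial s y′ n * x
  intertwine-fallingFactorial {x = x} zero xy≈y′x xs≈sx = 1#-commute x
  intertwine-fallingFactorial {s} {x} {y} {y′} (suc n) xy≈y′x xs≈sx = begin
    x * (fallingFactorial s y n * (y - n × s))    ≈⟨ *-assoc _ _ _ ⟨
    x * fallingFactorial s y n * (y - n × s)
      ≈⟨ *-congʳ (intertwine-fallingFactorial n xy≈y′x xs≈sx) ⟩
    fallingFactorial s y′ n * x * (y - n × s)     ≈⟨ *-assoc _ _ _ ⟩
    fallingFactorial s y′ n * (x * (y - n × s))
      ≈⟨ *-congˡ (intertwine-- xy≈y′x (×-commute n xs≈sx)) ⟩
    fallingFactorial s y′ n * ((y′ - n × s) * x)  ≈⟨ *-assoc _ _ _ ⟨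
    fallingFactorial s y′ n * (y′ - n × s) * x    ∎

  -- Uniqueness of coefficients in expansions by falling factorials.

  fallingFactorial-vanishes : ∀ k j → k ℕ.< j → fallingFactorial 1# (k × 1#) j ≈ 0#
  fallingFactorial-vanishes k (suc j) k<1+j with ℕ.m≤n⇒m<n∨m≡n (s≤s⁻¹ k<1+j)
  ... | inj₁ k<j    = trans (*-congʳ (fallingFactorial-vanishes k j k<j)) (zeroˡ _)
  -- Here `j` equals `k`, so the factor just appended is k - k.
  ... | inj₂ ≡.refl = trans (*-congˡ (-‿inverseʳ (k × 1#))) (zeroʳ _)

  -- Stands in for division by factorials: cancelling positive integers is enough below, and over
  -- the Cauchy reals this can be proved without constructing inverses.
  TorsionFree : Set _
  TorsionFree = ∀ n x → (suc n × 1#) * x ≈ 0# → x ≈ 0#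

  module _ (torsionFree : TorsionFree) where

    -- At x = j + d the factors are j + d, ..., d + 1, all positive integers. The last one is
    -- cancelled by torsion-freeness, and the induction continues with one unit moved from `j` to
    -- `d`.
    fallingFactorial-cancel : ∀ {x} j d y → x ≈ j × 1# + d × 1# →
      y * fallingFactorial 1# x j ≈ 0# → y ≈ 0#
    fallingFactorial-cancel zero d y _ y*1≈0 = trans (sym (*-identityʳ y)) y*1≈0
    fallingFactorial-cancel {x} (suc j) d y x≈ y*xⱼ*f≈0 =
      fallingFactorial-cancel j (suc d) y x≈′ (torsionFree d _ (begin
        (suc d × 1#) * (y * fallingFactorial 1# x j)
          ≈⟨ ×-commute (suc d) (1#-commute _) ⟨
        y * fallingFactorial 1# x j * (suc d × 1#)
          ≈⟨ *-congˡ (trans (-‿cong₂ x≈′ refl) ([y+x]-y≈x _ _)) ⟨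
        y * fallingFactorial 1# x j * (x - j × 1#)    ≈⟨ *-assoc _ _ _ ⟩
        y * fallingFactorial 1# x (suc j)             ≈⟨ y*xⱼ*f≈0 ⟩
        0#                                            ∎))
      where
      x≈′ : x ≈ j × 1# + suc d × 1#
      x≈′ = begin
        x                             ≈⟨ x≈ ⟩
        1# + j × 1# + d × 1#          ≈⟨ +-congʳ (+-comm 1# (j × 1#)) ⟩
        j × 1# + 1# + d × 1#          ≈⟨ +-assoc _ _ _ ⟩
        j × 1# + suc d × 1#           ∎

    -- Strong induction on `k`, evaluating at x = k: terms with smaller index vanish by induction,
    -- terms with larger index contain the factor zero, and what is left is k! times `f k`.
    newton-independent : ∀ m (f : ℕ → Carrier) →
      (∀ x → sumTo m (λ k → f k * fallingFactorial 1# x k) ≈ 0#) →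
      ∀ k → k ℕ.≤ m → f k ≈ 0#
    newton-independent m f Σ≈0 = <-rec (λ k → k ℕ.≤ m → f k ≈ 0#) λ k ih k≤m →
      fallingFactorial-cancel k 0 (f k) (sym (+-identityʳ (k × 1#))) (begin
        f k * fallingFactorial 1# (k × 1#) k
          ≈⟨ sumTo-single m (λ j → f j * fallingFactorial 1# (k × 1#) j) k k≤m
               (others≈0 k ih) ⟨
        sumTo m (λ j → f j * fallingFactorial 1# (k × 1#) j)
          ≈⟨ Σ≈0 (k × 1#) ⟩
        0# ∎)
      where
      others≈0 : ∀ k → (∀ {j} → j ℕ.< k → j ℕ.≤ m → f j ≈ 0#) →
                 ∀ j → j ℕ.≤ m → j ≢ k → f j * fallingFactorial 1# (k × 1#) j ≈ 0#
      others≈0 k ih j j≤m j≢k with ℕ.<-cmp j k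
      ... | tri< j<k _ _ = trans (*-congʳ (ih j<k j≤m)) (zeroˡ _)
      ... | tri≈ _ j≡k _ = contradiction j≡k j≢k
      ... | tri> _ _ k<j = trans (*-congˡ (fallingFactorial-vanishes k j k<j)) (zeroʳ _)

    newton-unique : ∀ m (f g : ℕ → Carrier) →
      (∀ x → sumTo m (λ k → f k * fallingFactorial 1# x k) ≈
             sumTo m (λ k → g k * fallingFactorial 1# x k)) →
      ∀ k → k ℕ.≤ m → f k ≈ g k
    newton-unique m f g Σf≈Σg k k≤m = GroupProperties.x∙y⁻¹≈ε⇒x≈y +-group (f k) (g k)
      (newton-independent m (λ j → f j - g j) Σ[f-g]≈0 k k≤m)
      where
      -- Adding Σ g back to the difference sum gives Σ f, which equals Σ g; hence the difference sum
      -- is zero.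
      Σ[f-g]≈0 : ∀ x → sumTo m (λ j → (f j - g j) * fallingFactorial 1# x j) ≈ 0#
      Σ[f-g]≈0 x = identityˡ-unique (sumTo m d) (sumTo m g′) (begin
        sumTo m d + sumTo m g′       ≈⟨ sumTo-+ m d g′ ⟨
        sumTo m (λ j → d j + g′ j)   ≈⟨ sumTo-cong m (λ j → d j + g′ j) f′ (λ j _ → d+g′≈f′ j) ⟩
        sumTo m f′                   ≈⟨ Σf≈Σg x ⟩
        sumTo m g′                   ∎)
        where
        p d f′ g′ : ℕ → Carrier
        p    = fallingFactorial 1# x
        d  j = (f j - g j) * p j
        f′ j = f j * p j
        g′ j = g j * p j

        d+g′≈f′ : ∀ j → d j + g′ j ≈ f′ j
        d+g′≈f′ j = trans (sym (distribʳ (p j) (f j - g j) (g j)))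
                          (*-congʳ (//-rightDividesˡ (g j) (f j)))

-- The Stirling recurrence and the expansion it gives in every algebra.

module Stirling (R : CommutativeRing c ℓ) (lam : CommutativeRing.Carrier R) where
  open CommutativeRing R
  open Mult semiring
  open SetoidReasoning setoid

  weight : ℕ → ℕ → Carrier
  weight n k = k × 1# - n × lam

  stirling : ℕ → ℕ → Carrier
  stirling zero    zero    = 1#
  stirling zero    (suc k) = 0#
  stirling (suc n) zero    = weight n 0 * stirling n 0
  stirling (suc n) (suc k) = stirling n k + weight n (suc k) * stirling n (suc k)

  -- Needed at k = n + 1, where it supplies the boundary term in the induction for
  -- `stirling-expansion`.
  stirling-vanishes : ∀ n k → n ℕ.< k → stirling n k ≈ 0#
  stirling-vanishes zero    (suc k) _     = refl
  stirling-vanishes (suc n) (suc k) n+1<k+1 = begin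
    stirling n k + weight n (suc k) * stirling n (suc k)
      ≈⟨ +-cong (stirling-vanishes n k n<k)
                (*-congˡ (stirling-vanishes n (suc k) (ℕ.m<n⇒m<1+n n<k))) ⟩
    0# + weight n (suc k) * 0#    ≈⟨ +-identityˡ _ ⟩
    weight n (suc k) * 0#         ≈⟨ zeroʳ _ ⟩
    0#                            ∎
    where
    n<k : n ℕ.< k
    n<k = s≤s⁻¹ n+1<k+1

-- Stated over any commutative ring so that one expansion theorem serves twice: for the operator
-- algebra, and for `R` as an algebra over itself, where it identifies the coefficients.
record IsAlgebra (R : CommutativeRing c ℓ) (A : Ring c′ ℓ′)
  (_•_ : CommutativeRing.Carrier R → Ring.Carrier A → Ring.Carrier A) :
  Set (c ⊔ ℓ ⊔ c′ ⊔ ℓ′) where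
  open Ring A
  field
    isLeftModule : IsLeftModule (CommutativeRing.ring R) _≈_ _+_ 0# -_ _•_
    •-*-assocˡ   : ∀ r x y → (r • x) * y ≈ r • (x * y)
    •-*-assocʳ   : ∀ r x y → x * (r • y) ≈ r • (x * y)

module Algebras (R : CommutativeRing c ℓ) (A : Ring c′ ℓ′)
  (_•_ : CommutativeRing.Carrier R → Ring.Carrier A → Ring.Carrier A)
  (isAlgebra : IsAlgebra R A _•_)
  where

  open Ring A
  open IsAlgebra isAlgebra
  open FallingFactorials A
  open IsLeftModule isLeftModule
    using (*ₗ-cong; *ₗ-distribˡ; *ₗ-distribʳ; *ₗ-assoc; *ₗ-identityˡ; *ₗ-zeroˡ)
  open GroupProperties +-group using (inverseˡ-unique)
  open SetoidReasoning setoid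
  private
    module R = CommutativeRing R
    module RM = Mult R.semiring

  •-congˡ : ∀ {r x y} → x ≈ y → r • x ≈ r • y
  •-congˡ = *ₗ-cong R.refl

  •-congʳ : ∀ {r s x} → r R.≈ s → r • x ≈ s • x
  •-congʳ r≈s = *ₗ-cong r≈s refl

  scalar : R.Carrier → Carrier
  scalar r = r • 1#

  *-scalar : ∀ x r → x * scalar r ≈ r • x
  *-scalar x r = trans (•-*-assocʳ r x 1#) (•-congˡ (*-identityʳ x))

  scalar-* : ∀ x r → scalar r * x ≈ r • x
  scalar-* x r = trans (•-*-assocˡ r 1# x) (•-congˡ (*-identityˡ x))

  scalar-commute : ∀ x r → x * scalar r ≈ scalar r * x
  scalar-commute x r = trans (*-scalar x r) (sym (scalar-* x r))

  -‿• : ∀ r x → (R.- r) • x ≈ - (r • x)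
  -‿• r x = inverseˡ-unique _ _ (begin
    (R.- r) • x + r • x    ≈⟨ *ₗ-distribʳ x (R.- r) r ⟨
    (R.- r R.+ r) • x      ≈⟨ •-congʳ (R.-‿inverseˡ r) ⟩
    R.0# • x               ≈⟨ *ₗ-zeroˡ x ⟩
    0#                     ∎)

  scalar-× : ∀ n r → scalar (n RM.× r) ≈ n × scalar r
  scalar-× zero    r = *ₗ-zeroˡ 1#
  scalar-× (suc n) r = trans (*ₗ-distribʳ 1# r (n RM.× r)) (+-congˡ (scalar-× n r))

  scalar-×1 : ∀ n → scalar (n RM.× R.1#) ≈ n × 1#
  scalar-×1 n = trans (scalar-× n R.1#) (×-congʳ n (*ₗ-identityˡ 1#))

  -- Meant for `r` an embedded natural number: it turns mλ formed in the base ring into the m-fold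
  -- sum of the operator λ.
  scalar-*-× : ∀ r s n → scalar r ≈ n × 1# → scalar (r R.* s) ≈ n × scalar s
  scalar-*-× r s n r≈n = begin
    (r R.* s) • 1#          ≈⟨ *ₗ-assoc r s 1# ⟩
    r • scalar s            ≈⟨ scalar-* (scalar s) r ⟨
    scalar r * scalar s     ≈⟨ *-congʳ r≈n ⟩
    (n × 1#) * scalar s     ≈⟨ ×-assoc-* n 1# (scalar s) ⟩
    n × (1# * scalar s)     ≈⟨ ×-congʳ n (*-identityˡ (scalar s)) ⟩
    n × scalar s            ∎

  module Expansion (lam : R.Carrier) where
    open Stirling R lam

    scalar-weight : ∀ n k → scalar (weight n k) ≈ k × 1# - n × scalar lam
    scalar-weight n k = trans (*ₗ-distribʳ 1# _ _)
      (+-cong (scalar-×1 k) (trans (-‿• _ 1#) (-‿cong (scalar-× n lam))))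

    -- (X)_k (X − nλ) = (X)_{k+1} + (k − nλ) (X)_k, the source of the recurrence
    -- for stirling.
    fallingFactorial-*-weight : ∀ r x n k →
      (r • fallingFactorial 1# x k) * (x - n × scalar lam) ≈
      r • fallingFactorial 1# x (suc k) + (weight n k R.* r) • fallingFactorial 1# x k
    fallingFactorial-*-weight r x n k = begin
      (r • p) * (x - n × scalar lam)
        ≈⟨ •-*-assocˡ r p _ ⟩
      r • (p * (x - n × scalar lam))
        ≈⟨ •-congˡ (*-congˡ (trans (x-z≈[x-y]+[y-z] x (k × 1#) _)
                                   (+-congˡ (sym (scalar-weight n k))))) ⟩
      r • (p * ((x - k × 1#) + scalar (weight n k)))
        ≈⟨ •-congˡ (trans (distribˡ p _ _) (+-congˡ (*-scalar p (weight n k)))) ⟩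
      r • (p * (x - k × 1#) + weight n k • p)
        ≈⟨ *ₗ-distribˡ r _ _ ⟩
      r • (p * (x - k × 1#)) + r • (weight n k • p)
        ≈⟨ +-congˡ (trans (sym (*ₗ-assoc r (weight n k) p)) (•-congʳ (R.*-comm r (weight n k)))) ⟩
      r • (p * (x - k × 1#)) + (weight n k R.* r) • p
        ∎
      where
      p : Carrier
      p = fallingFactorial 1# x k

    -- Induction on `n`: multiplying the k-th term by the new factor x - nλ sends one part `up` to
    -- index k + 1 and keeps another part `stay` at index k. Collecting by index reproduces the
    -- recurrence.
    stirling-expansion : ∀ n x → fallingFactorial (scalar lam) x n ≈
      sumTo n (λ k → stirling n k • fallingFactorial 1# x k)
    stirling-expansion zero    x = sym (trans (+-identityʳ _) (*ₗ-identityˡ 1#))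
    stirling-expansion (suc n) x = begin
      fallingFactorial (scalar lam) x n * (x - n × scalar lam)
        ≈⟨ *-congʳ (stirling-expansion n x) ⟩
      sumTo n (λ k → stirling n k • p k) * (x - n × scalar lam)
        ≈⟨ sumTo-*ʳ n (λ k → stirling n k • p k) (x - n × scalar lam) ⟩
      sumTo n (λ k → (stirling n k • p k) * (x - n × scalar lam))
        ≈⟨ sumTo-cong n (λ k → (stirling n k • p k) * (x - n × scalar lam)) (λ k → up k + stay k) (λ k _ → fallingFactorial-*-weight (stirling n k) x n k) ⟩
      sumTo n (λ k → up k + stay k)
        ≈⟨ sumTo-+ n up stay ⟩
      sumTo n up + sumTo n stay
        -- Appending the zero term `stay (suc n)` lengthens the sum by one, so that after `stay 0`
        -- is split off the rest has n + 1 terms again and lines up with `up`.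
        ≈⟨ +-congˡ (trans (sumTo-last n stay) (trans (+-congˡ stay-vanishes) (+-identityʳ _))) ⟨
      sumTo n up + (stay 0 + sumTo n (stay ∘ suc))
        ≈⟨ +-assoc _ _ _ ⟨
      sumTo n up + stay 0 + sumTo n (stay ∘ suc)
        ≈⟨ +-congʳ (+-comm _ _) ⟩
      stay 0 + sumTo n up + sumTo n (stay ∘ suc)
        ≈⟨ +-assoc _ _ _ ⟩
      stay 0 + (sumTo n up + sumTo n (stay ∘ suc))
        ≈⟨ +-congˡ (sumTo-+ n up (stay ∘ suc)) ⟨
      stay 0 + sumTo n (λ k → up k + stay (suc k))
        -- The recurrence, termwise; `stay 0` is already the k = 0 term of the target by definition.
        ≈⟨ +-congˡ (sumTo-cong n (λ k → stirling (suc n) (suc k) • p (suc k))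
                                  (λ k → up k + stay (suc k))
                                  (λ k _ → *ₗ-distribʳ (p (suc k)) _ _)) ⟨
      sumTo (suc n) (λ k → stirling (suc n) k • p k)
        ∎
      where
      p up stay : ℕ → Carrier
      p = fallingFactorial 1# x
      up   k = stirling n k • p (suc k)
      stay k = (weight n k R.* stirling n k) • p k

      stay-vanishes : stay (suc n) ≈ 0#
      stay-vanishes = trans
        (•-congʳ (R.trans (R.*-congˡ (stirling-vanishes n (suc n) ℕ.≤-refl)) (R.zeroʳ _)))
        (*ₗ-zeroˡ _)

-- Commutation of boson operators with the number operator.

IsBosonPair : (A : Ring c ℓ) → Ring.Carrier A → Ring.Carrier A → Set ℓ
IsBosonPair A a a⁺ = a * a⁺ - a⁺ * a ≈ 1#
  where open Ring A

module Boson (A : Ring c ℓ) (a a⁺ : Ring.Carrier A)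
  (commutator : IsBosonPair A a a⁺) where

  open Ring A
  open FallingFactorials A
  open GroupProperties +-group using (//-rightDividesˡ; //-rightDividesʳ)
  open SetoidReasoning setoid

  N : Carrier
  N = a⁺ * a

  -- The commutation relation rewrites `a * a⁺` as `N + 1#`.
  a*N : a * N ≈ (N + 1#) * a
  a*N = begin
    a * (a⁺ * a)                ≈⟨ *-assoc a a⁺ a ⟨
    a * a⁺ * a                  ≈⟨ *-congʳ (//-rightDividesˡ N (a * a⁺)) ⟨
    (a * a⁺ - N + N) * a        ≈⟨ *-congʳ (trans (+-congʳ commutator) (+-comm 1# N)) ⟩
    (N + 1#) * a                ∎

  a^j*N : ∀ j → a ^ j * N ≈ (N + j × 1#) * a ^ j
  a^j*N zero    = trans (sym (1#-commute N)) (*-congʳ (sym (+-identityʳ N)))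
  a^j*N (suc j) = begin
    a * a ^ j * N                        ≈⟨ *-assoc a (a ^ j) N ⟩
    a * (a ^ j * N)                      ≈⟨ *-congˡ (a^j*N j) ⟩
    a * ((N + j × 1#) * a ^ j)           ≈⟨ *-assoc _ _ _ ⟨
    a * (N + j × 1#) * a ^ j             ≈⟨ *-congʳ (distribˡ a N (j × 1#)) ⟩
    (a * N + a * (j × 1#)) * a ^ j       ≈⟨ *-congʳ (+-cong a*N (×-commute j (1#-commute a))) ⟩
    ((N + 1#) * a + (j × 1#) * a) * a ^ j ≈⟨ *-congʳ (distribʳ a (N + 1#) (j × 1#)) ⟨
    (N + 1# + j × 1#) * a * a ^ j        ≈⟨ *-assoc _ _ _ ⟩
    (N + 1# + j × 1#) * (a * a ^ j)      ≈⟨ *-congʳ (+-assoc N 1# (j × 1#)) ⟩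
    (N + suc j × 1#) * a ^ suc j         ∎

  a^j*[N-j] : ∀ j → a ^ j * (N - j × 1#) ≈ N * a ^ j
  a^j*[N-j] j = trans
    (intertwine-- (a^j*N j) (×-commute j (1#-commute (a ^ j))))
    (*-congʳ (//-rightDividesʳ (j × 1#) N))

  ^-sucʳ : ∀ x n → x ^ suc n ≈ x ^ n * x
  ^-sucʳ x zero    = 1#-commute x
  ^-sucʳ x (suc n) = trans (*-congˡ (^-sucʳ x n)) (sym (*-assoc x (x ^ n) x))

  -- In the product for j + 1 the innermost `a⁺ * a` is `N`. Carried to the right across `a ^ j` it
  -- becomes N - j, exactly the new last factor of the falling factorial.
  a⁺^j*a^j : ∀ j → a⁺ ^ j * a ^ j ≈ fallingFactorial 1# N j
  a⁺^j*a^j zero    = *-identityˡ 1#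
  a⁺^j*a^j (suc j) = begin
    a⁺ ^ suc j * (a * a ^ j)         ≈⟨ *-congʳ (^-sucʳ a⁺ j) ⟩
    a⁺ ^ j * a⁺ * (a * a ^ j)        ≈⟨ *-assoc _ _ _ ⟩
    a⁺ ^ j * (a⁺ * (a * a ^ j))      ≈⟨ *-congˡ (*-assoc _ _ _) ⟨
    a⁺ ^ j * (N * a ^ j)             ≈⟨ *-congˡ (a^j*[N-j] j) ⟨
    a⁺ ^ j * (a ^ j * (N - j × 1#))  ≈⟨ *-assoc _ _ _ ⟨
    a⁺ ^ j * a ^ j * (N - j × 1#)    ≈⟨ *-congʳ (a⁺^j*a^j j) ⟩
    fallingFactorial 1# N (suc j)    ∎

  -- Pulling `a ^ j` leftwards through the middle factor undoes the shift by j, after which `a⁺ ^ j`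
  -- and `a ^ j` stand side by side. In use `s` is λ and `u` is mλ, both scalars.
  normal-order : ∀ {s u} j n → a ^ j * s ≈ s * a ^ j → a ^ j * u ≈ u * a ^ j →
    a⁺ ^ j * fallingFactorial s (N + j × 1# - u) n * a ^ j ≈
    fallingFactorial 1# N j * fallingFactorial s (N - u) n
  normal-order {s} {u} j n s-commute u-commute = begin
    a⁺ ^ j * fallingFactorial s (N + j × 1# - u) n * a ^ j
      ≈⟨ *-assoc _ _ _ ⟩
    a⁺ ^ j * (fallingFactorial s (N + j × 1# - u) n * a ^ j)
      ≈⟨ *-congˡ (intertwine-fallingFactorial n (intertwine-- (a^j*N j) u-commute) s-commute) ⟨
    a⁺ ^ j * (a ^ j * fallingFactorial s (N - u) n)
      ≈⟨ *-assoc _ _ _ ⟨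
    a⁺ ^ j * a ^ j * fallingFactorial s (N - u) n
      ≈⟨ *-congʳ (a⁺^j*a^j j) ⟩
    fallingFactorial 1# N j * fallingFactorial s (N - u) n ∎

-- Identification of the given coefficients and the general identity.

module StirlingUnique (R : CommutativeRing c ℓ) where
  open CommutativeRing R
  open FallingFactorials ring

  *-isAlgebra : IsAlgebra R ring _*_
  *-isAlgebra = record
    { isLeftModule = LeftModule.isLeftModule TensorUnit.leftModule
    ; •-*-assocˡ   = *-assoc
    ; •-*-assocʳ   = λ r x y →
        trans (sym (*-assoc x r y)) (trans (*-congʳ (*-comm x r)) (*-assoc r x y))
    }

  open Algebras R ring _*_ *-isAlgebra
  open Stirling R using (stirling)

  stirling-unique : TorsionFree → ∀ lam n (f : ℕ → Carrier) →
    (∀ x → fallingFactorial lam x n ≈ sumTo n (λ k → f k * fallingFactorial 1# x k)) →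
    ∀ k → k ℕ.≤ n → f k ≈ stirling lam n k
  stirling-unique torsionFree lam n f expansion =
    newton-unique torsionFree n f (stirling lam n) λ x →
      trans (sym (expansion x))
        -- For `R` acting on itself, `scalar lam` is `lam * 1#` rather than `lam`.
        (trans (fallingFactorial-cong n (sym (*-identityʳ lam)) refl)
          (Expansion.stirling-expansion lam n x))

module NormalOrdering (R : CommutativeRing c ℓ)
  (torsionFree : FallingFactorials.TorsionFree (CommutativeRing.ring R))
  (A : Ring c′ ℓ′) (_•_ : CommutativeRing.Carrier R → Ring.Carrier A → Ring.Carrier A)
  (isAlgebra : IsAlgebra R A _•_) (a a⁺ : Ring.Carrier A)
  (commutator : IsBosonPair A a a⁺) (lam : CommutativeRing.Carrier R) where

  open Ring A
  open IsAlgebra isAlgebra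
  open FallingFactorials A
  open Algebras R A _•_ isAlgebra
  open Expansion lam
  open Stirling R lam using (stirling)
  open Boson A a a⁺ commutator
  open SetoidReasoning setoid
  private
    module R = CommutativeRing R
    module RF = FallingFactorials R.ring

  normalOrdering : ∀ (S : ℕ → R.Carrier) m n →
    (∀ x → RF.fallingFactorial lam x m R.≈
           RF.sumTo m (λ k → S k R.* RF.fallingFactorial R.1# x k)) →
    fallingFactorial (scalar lam) N (m ℕ.+ n) ≈
    sumTo m (λ j → S j • (a⁺ ^ j
      * fallingFactorial (scalar lam) (N + j × 1# - m × scalar lam) n * a ^ j))
  normalOrdering S m n S-expansion = begin
    fallingFactorial (scalar lam) N (m ℕ.+ n)
      ≈⟨ fallingFactorial-+ (scalar lam) N m n ⟩
    fallingFactorial (scalar lam) N m * fallingFactorial (scalar lam) (N - m × scalar lam) n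
      ≈⟨ *-congʳ (stirling-expansion m N) ⟩
    sumTo m newton * rest              ≈⟨ sumTo-*ʳ m newton rest ⟩
    sumTo m (λ j → newton j * rest)    ≈⟨ sumTo-cong m (λ j → newton j * rest) ordered term ⟩
    sumTo m ordered                    ∎
    where
    rest : Carrier
    rest = fallingFactorial (scalar lam) (N - m × scalar lam) n

    newton ordered : ℕ → Carrier
    newton  j = stirling m j • fallingFactorial 1# N j
    ordered j = S j • (a⁺ ^ j
      * fallingFactorial (scalar lam) (N + j × 1# - m × scalar lam) n * a ^ j)

    term : ∀ j → j ℕ.≤ m → newton j * rest ≈ ordered j
    term j j≤m = begin
      (stirling m j • fallingFactorial 1# N j) * rest
        ≈⟨ •-*-assocˡ _ _ _ ⟩
      stirling m j • (fallingFactorial 1# N j * rest)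
        -- The given coefficients replace the recursive ones here; uniqueness reaches the indices up
        -- to m, which are those of the sum.
        ≈⟨ •-congʳ (StirlingUnique.stirling-unique R torsionFree lam m S S-expansion j j≤m) ⟨
      S j • (fallingFactorial 1# N j * rest)
        ≈⟨ •-congˡ (normal-order j n (scalar-commute (a ^ j) lam)
             (×-commute m (scalar-commute (a ^ j) lam))) ⟨
      ordered j
        ∎

-- Torsion-freeness of the reals.

fromℕ-nonNegative : ∀ n i → 0ℚ ℚ.≤ ℝ.seq (fromℕ n) i
fromℕ-nonNegative zero    i = ℚ.≤-refl
fromℕ-nonNegative (suc n) i =
  ℚ.+-mono-≤ (ℚ.<⇒≤ (ℚ.positive⁻¹ 1ℚ)) (fromℕ-nonNegative n i)

1≤p⇒∣q∣≤∣p*q∣ : ∀ {p} q → 1ℚ ℚ.≤ p → ℚ.∣ q ∣ ℚ.≤ ℚ.∣ p ℚ.* q ∣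
1≤p⇒∣q∣≤∣p*q∣ {p} q 1≤p = begin
  ℚ.∣ q ∣              ≡⟨ ℚ.*-identityˡ ℚ.∣ q ∣ ⟨
  1ℚ ℚ.* ℚ.∣ q ∣       ≤⟨ ℚ.*-monoʳ-≤-nonNeg ℚ.∣ q ∣ {{ℚ.∣-∣-nonNeg q}} 1≤p ⟩
  p ℚ.* ℚ.∣ q ∣        ≡⟨ ≡.cong (ℚ._* ℚ.∣ q ∣) (ℚ.0≤p⇒∣p∣≡p (ℚ.≤-trans 0≤1 1≤p)) ⟨
  ℚ.∣ p ∣ ℚ.* ℚ.∣ q ∣  ≡⟨ ℚ.∣p*q∣≡∣p∣*∣q∣ p q ⟨
  ℚ.∣ p ℚ.* q ∣        ∎
  where
  open ℚ.≤-Reasoning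
  0≤1 : 0ℚ ℚ.≤ 1ℚ
  0≤1 = ℚ.<⇒≤ (ℚ.positive⁻¹ 1ℚ)

-- The sequence of n + 1 is at least 1 in every place, so each term of `x` is bounded by the
-- matching term of the product, and the same threshold `M` works for both.
ℝ-torsionFree : FallingFactorials.TorsionFree ℝ-ring
ℝ-torsionFree n x nx≈0 ε ε>0 with nx≈0 ε ε>0
... | M , close = M , λ i M≤i → ℚ.≤-<-trans
  (≡.subst₂ ℚ._≤_
    (≡.cong ℚ.∣_∣ (≡.sym (ℚ.+-identityʳ (ℝ.seq x i))))
    (≡.cong ℚ.∣_∣ (≡.sym (ℚ.+-identityʳ _)))
    (1≤p⇒∣q∣≤∣p*q∣ (ℝ.seq x i) (1≤fromℕ i)))
  (close i M≤i)
  where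
  1≤fromℕ : ∀ i → 1ℚ ℚ.≤ ℝ.seq (fromℕ (suc n)) i
  1≤fromℕ i = ≡.subst (ℚ._≤ ℝ.seq (fromℕ (suc n)) i) (ℚ.+-identityʳ 1ℚ)
    (ℚ.+-monoʳ-≤ 1ℚ (fromℕ-nonNegative n i))

-- Specialisation to real algebras.

open Sum (Ring.semiring ℝ-ring) using (sum)

seq-sum-cong : ∀ {n} {f g : Fin n → ℝ} →
  (∀ i k → ℝ.seq (f i) k ≡ ℝ.seq (g i) k) → ∀ k → ℝ.seq (sum f) k ≡ ℝ.seq (sum g) k
seq-sum-cong {zero}  f≗g k = ≡.refl
seq-sum-cong {suc n} f≗g k =
  ≡.cong₂ ℚ._+_ (f≗g zero k) (seq-sum-cong (λ i → f≗g (suc i)) k)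

-- Definitionally equal sums of reals are too expensive to compare inside _≈ℝ_, as
-- η for ℝ makes the comparison unfold the Cauchy moduli of the summands. With
-- the summands f and g left to unification, only their sequences are compared.
sum-tail-cong : ∀ n (u v : ℝ) {f g : Fin n → ℝ} →
  (∀ ε → 0ℚ ℚ.< ε → ∃[ M ] (∀ k → M ℕ.≤ k →
    ℚ.∣ ℝ.seq u k ℚ.- (ℝ.seq v k ℚ.+ ℝ.seq (sum f) k) ∣ ℚ.< ε)) →
  (∀ i k → ℝ.seq (f i) k ≡ ℝ.seq (g i) k) →
  (∀ ε → 0ℚ ℚ.< ε → ∃[ M ] (∀ k → M ℕ.≤ k →
    ℚ.∣ ℝ.seq u k ℚ.- (ℝ.seq v k ℚ.+ ℝ.seq (sum g) k) ∣ ℚ.< ε))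
sum-tail-cong n u v u≈v+Σf f≗g ε ε>0 with u≈v+Σf ε ε>0
... | M , close = M , λ k M≤k →
  ≡.subst (λ t → ℚ.∣ ℝ.seq u k ℚ.- (ℝ.seq v k ℚ.+ t) ∣ ℚ.< ε) (seq-sum-cong f≗g k)
    (close k M≤k)

theorem2p4 : ∀ {c ℓ} (A : RealAlgebra c ℓ) →
    let open RealAlgebra A in
    (a a⁺ : Carrier) → a * a⁺ - a⁺ * a ≈ 1# →
    (lam : ℝ) → ¬ (lam ≈ℝ 0ℝ) →
    (S : ℕ → ℕ → ℝ) → IsDegenerateStirling₂ lam S →
    (m n : ℕ) →
    degenerateFactorial lam (a⁺ * a) (m ℕ.+ n) ≈
    sumTo m (λ j →
    S m j • (a⁺ ^ j
    * degenerateFactorial lam (a⁺ * a + scalar (fromℕ j) - scalar (fromℕ m *ℝ lam)) n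
    * a ^ j))
theorem2p4 A a a⁺ commutator lam _ S S-expansion m n =
  trans (normalOrdering (S m) m n λ x →
           -- `S m 0 *ℝ 1ℝ` is the k = 0 summand, split off by the unfolding of the sum; the other m
           -- summands form the tail.
           sum-tail-cong m (RingNotation.fallingFactorial ℝ-ring lam x m) (S m 0 *ℝ 1ℝ)
             (S-expansion m x) (λ _ _ → ≡.refl))
    -- Rewrites the integer multiples j·1 and m·λ as the scalars that occur in the statement.
    (sumTo-cong m
      (λ j → S m j • (a⁺ ^ j
        * fallingFactorial (scalar lam) (N + j × 1# - m × scalar lam) n * a ^ j))
      (λ j → S m j • (a⁺ ^ j
        * fallingFactorial (scalar lam)
            (N + scalar (fromℕ j) - scalar (fromℕ m *ℝ lam)) n * a ^ j))
      (λ j _ → Alg.•-congˡ {S m j} (*-congʳ (*-congˡ (fallingFactorial-cong n refl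
        (-‿cong₂ (+-congˡ (sym (fromℕ≈×1 j))) (sym fromℕ*lam≈×lam)))))))
  where
  open RealAlgebra A hiding (sumTo; fallingFactorial; _^_)
  open FallingFactorials ring
  module R = CommutativeRing ℝ-commutativeRing
  module RM = Mult R.semiring

  isAlgebra : IsAlgebra ℝ-commutativeRing ring _•_
  isAlgebra = record
    { isLeftModule = isLeftModule ; •-*-assocˡ = •-*-assocˡ ; •-*-assocʳ = •-*-assocʳ }

  module Alg = Algebras ℝ-commutativeRing ring _•_ isAlgebra
  open Boson ring a a⁺ commutator using (N)
  open NormalOrdering ℝ-commutativeRing ℝ-torsionFree ring _•_ isAlgebra a a⁺ commutator lam
    using (normalOrdering)

  fromℕ≈×1 : ∀ j → scalar (fromℕ j) ≈ j × 1#
  fromℕ≈×1 j = trans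
    (Alg.•-congʳ {fromℕ j} {j RM.× R.1#} (R.refl {fromℕ j})) (Alg.scalar-×1 j)

  fromℕ*lam≈×lam : scalar (fromℕ m *ℝ lam) ≈ m × scalar lam
  fromℕ*lam≈×lam = Alg.scalar-*-× (fromℕ m) lam m (fromℕ≈×1 m)
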